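{- Let $q\ge2$ be fixed. Then for every integer $t\ge 2$, \[ \limsup_{n\to\infty}\frac{\log_2 m_q(n,t)}{n}\le (2+o(1))\frac{\log_2 t}{t^2}, \] where $o(1)$ denotes a quantity tending to $0$ as $t\to\infty$. In particular, in the binary case ($q=2$) this bound holds for the maximum size of binary $t$-frameproof codes of length $n$.
   Context: Let $Q=\{0,1,\dots,q-1\}$. For a nonempty set $X=\{\mathbf c^1,\dots,\mathbf c^s\}\subseteq Q^n$, a position $i\in[n]$ is undetectable for $X$ if $c^1_i=\dots=c^s_i$; let $U(X)$ be the set of undetectable positions and $\mathrm{wdesc}(X)=\{\mathbf y\in Q^n: y_i=c^1_i \text{ for all } i\in U(X)\}$. For $t\ge2$, a code $\mathcal C\subseteq Q^n$ is a wide-sense $t$-frameproof code if $\mathrm{wdesc}(X)\cap\mathcal C=X$ for every nonempty $X\subseteq\mathcal C$ with $|X|\le t$; $m_q(n,t)$ is the maximum size of such a code. A binary $t$-frameproof code is $\mathcal C\subseteq\{0,1\}^n$ with $\mathrm{desc}(X)\cap\mathcal C=X$ for all nonempty $X\subseteq\mathcal C$, $|X|\le t$, where $\mathrm{desc}(X)=\{\mathbf y: y_i\in\{c^1_i,\dots,c^s_i\}\ \forall i\}$ (for $q=2$ this coincides with wide-sense). -}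

module Defs where

open import Data.Nat using (ℕ; suc; _+_; _*_; _^_; _≤_)
open import Data.Fin using (Fin)
open import Data.Vec using (Vec; lookup)
open import Data.List using (List; length)
open import Data.List.Membership.Propositional using (_∈_)
open import Data.List.Relation.Unary.Unique.Propositional using (Unique)
open import Data.List.Relation.Binary.Subset.Propositional using (_⊆_)
open import Data.Product using (_×_; ∃-syntax)
open import Relation.Binary.PropositionalEquality using (_≡_)

Word : ℕ → ℕ → Set
Word q n = Vec (Fin q) n

-- A code is a duplicate-free list of words; its size is its length.
-- A subset X of a code is a duplicate-free list of words all lying in the code.

Undetectable : ∀ {q n} → List (Word q n) → Fin n → Set
Undetectable X i = ∀ {c c′} → c ∈ X → c′ ∈ X → lookup c i ≡ lookup c′ i

InWdesc : ∀ {q n} → List (Word q n) → Word q n → Set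
InWdesc X y = ∀ i → Undetectable X i → ∀ {c} → c ∈ X → lookup y i ≡ lookup c i

InDesc : ∀ {q n} → List (Word q n) → Word q n → Set
InDesc X y = ∀ i → ∃[ c ] (c ∈ X × lookup y i ≡ lookup c i)

SmallSubset : ∀ {q n} → ℕ → List (Word q n) → List (Word q n) → Set
SmallSubset t C X = Unique X × X ⊆ C × 1 ≤ length X × length X ≤ t

-- Wide-sense t-frameproof: wdesc(X) ∩ C = X (the inclusion X ⊆ wdesc(X) ∩ C is automatic).
WideSenseFrameproof : ∀ {q n} → ℕ → List (Word q n) → Set
WideSenseFrameproof t C =
  Unique C × (∀ X → SmallSubset t C X → ∀ y → y ∈ C → InWdesc X y → y ∈ X)

BinaryFrameproof : ∀ {n} → ℕ → List (Word 2 n) → Set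
BinaryFrameproof t C =
  Unique C × (∀ X → SmallSubset t C X → ∀ y → y ∈ C → InDesc X y → y ∈ X)

-- "limsup_n log₂|C_n|/n ≤ (2+o(1)) log₂ t / t²" for the property P of codes,
-- unfolded over ℕ: for every k ≥ 1 there is T such that for every t ≥ max(T,2)
-- there is N such that for all n ≥ N every code C of length n with P t C satisfies
--   log₂|C| / n ≤ (2 + 1/k) log₂ t / t², i.e.  |C|^(k t²) ≤ t^((2k+1) n).
AsymptoticBound : (q : ℕ) → ((t : ℕ) → ∀ {n} → List (Word q n) → Set) → Set
AsymptoticBound q P =
  ∀ (k : ℕ) → 1 ≤ k →
  ∃[ T ] ∀ (t : ℕ) → 2 ≤ t → T ≤ t →
  ∃[ N ] ∀ (n : ℕ) → N ≤ n → ∀ (C : List (Word q n)) → P t C →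
  length C ^ (k * (t * t)) ≤ t ^ ((2 * k + 1) * n)

{-# OPTIONS --safe #-}
-- Fix a codeword c₀. The sets of positions where the other codewords differ from c₀ form
-- a (t - 1)-cover-free family on n points: no set is covered by t - 1 others. For an
-- s-cover-free family on a ground set D, a set meeting at least 2|D|/s of D can be deleted
-- together with the points it meets; this leaves an (s - 1)-cover-free family on at most
-- |D|(s - 2)/s points, and |D| / (s(s - 1)) does not grow. Once every set has fewer than
-- 2|D|/s points, pad each to a grid with u ≈ 2|D|/s² rows and s columns. The s cyclic shifts
-- of a transversal partition the grid, so one of them lies in no other set. Hence each set
-- has at least s^u / s private transversals, and |F| ≤ s (|D| + su choose u) / s^u ≤ s (8s)^u.
module Submission where

open import Defs
open import Data.Fin using (Fin; zero; suc; toℕ; fromℕ<; combine; remQuot; finToFun; funToFin)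
open import Data.Fin.Properties using (_≟_; toℕ<n; toℕ≤n; toℕ-injective; toℕ-fromℕ<; ¬∀⟶∃¬; injective⇒≤; combine-injective; combine-remQuot; funToFin-finToFin)
open import Data.List as List using (List; []; _∷_; map; _++_; length; filter; tabulate; upTo; drop; allFin; deduplicate)
open import Data.List.Membership.Propositional using (_∈_; _∉_; find; lose)
open import Data.List.Membership.Propositional.Properties using (∈-map⁺; ∈-map⁻; ∈-++⁺ˡ; ∈-++⁺ʳ; ∈-++⁻; ∈-filter⁺; ∈-tabulate⁺; ∈-tabulate⁻; ∈-∃++; ∈-allFin; ∈-deduplicate⁺; ∈-deduplicate⁻)
open import Data.List.Properties using (length-map; length-++; length-drop; length-upTo; length-tabulate; length-deduplicate)
open import Data.List.Relation.Binary.Permutation.Propositional using (_↭_; ↭-sym; ↭⇒↭ₛ)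
open import Data.List.Relation.Binary.Permutation.Propositional.Properties using (∈-resp-↭; ↭-length) renaming (shift to ↭-shift)
import Data.List.Relation.Binary.Permutation.Setoid.Properties as ↭ₛ
open import Data.List.Relation.Binary.Sublist.Propositional using (from∈; minimum; _∷ʳ_; _∷_) renaming (_⊆_ to _⊑_; ⊆-trans to ⊑-trans; ⊆-reflexive to ⊑-reflexive; lookup to ⊑-lookup)
open import Data.List.Relation.Binary.Sublist.Propositional.Properties using () renaming (++⁺ to ⊑-++⁺; map⁺ to ⊑-map⁺; filter-⊆ to filter-⊑; drop-⊆ to drop-⊑)
open import Data.List.Relation.Binary.Subset.Propositional using (_⊆_)
open import Data.List.Relation.Unary.All as All using (All)
import Data.List.Relation.Unary.All.Properties as All
open import Data.List.Relation.Unary.AllPairs as AllPairs using ([]; _∷_)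
open import Data.List.Relation.Unary.Any as Any using (Any; here; there)
open import Data.List.Relation.Unary.Any.Properties using (lookup-index)
open import Data.List.Relation.Unary.Unique.DecPropositional.Properties using (deduplicate-!)
open import Data.List.Relation.Unary.Unique.Propositional using (Unique)
import Data.List.Relation.Unary.Unique.Propositional.Properties as Unique
open import Data.Nat using (ℕ; zero; suc; _+_; _*_; _∸_; _^_; _≤_; _<_; z≤n; s≤s; NonZero; >-nonZero)
open import Data.Nat.DivMod using (_/_; _%_; m/n*n≤m; m≡m%n+[m/n]*n; m%n<n; m<n⇒m%n≡m; m%n%n≡m%n; [m+n]%n≡m%n; %-distribˡ-+)
open import Data.Nat.Properties hiding (_≟_)
open import Data.Nat.Tactic.RingSolver using (solve-∀)
open import Data.Product using (∃-syntax; _×_; _,_; proj₁; proj₂; uncurry)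
open import Data.Sum using (_⊎_; inj₁; inj₂; [_,_])
open import Data.Sum.Properties using (inj₁-injective; inj₂-injective)
open import Data.Unit using (⊤; tt)
open import Data.Vec as Vec using (Vec; []; _∷_; toList; lookup)
open import Data.Vec.Membership.Propositional.Properties using (∈-toList⁺; ∈-toList⁻; ∈-lookup; ∈-fromList⁻)
import Data.Vec.Properties as Vec
open import Data.Vec.Relation.Unary.All.Properties using (fromList⁺)
open import Data.Vec.Relation.Unary.AllPairs using ([]; _∷_)
import Data.Vec.Relation.Unary.Any as VecAny
import Data.Vec.Relation.Unary.Any.Properties as VecAny
open import Data.Vec.Relation.Unary.Unique.Propositional using () renaming (Unique to VecUnique)
import Data.Vec.Relation.Unary.Unique.Propositional.Properties as VecUnique
open import Function using (_∘_; id)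
open import Relation.Binary.Definitions using (DecidableEquality)
open import Relation.Binary.PropositionalEquality using (_≡_; _≢_; _≗_; refl; sym; trans; cong; cong₂; subst; setoid; module ≡-Reasoning)
open import Relation.Nullary using (Dec; yes; no; ¬_; contradiction)
open import Relation.Nullary.Decidable using (_×-dec_; ¬?; decidable-stable)
open import Relation.Unary using (Decidable)

private
  variable
    A : Set

-- Elementary power estimates.

^-distribʳ-* : ∀ n a b → (a * b) ^ n ≡ a ^ n * b ^ n
^-distribʳ-* zero    a b = refl
^-distribʳ-* (suc n) a b rewrite ^-distribʳ-* n a b = [m*n]*[o*p]≡[m*o]*[n*p] a b (a ^ n) (b ^ n)

^-cancelˡ-≤ : ∀ n .{{_ : NonZero n}} {a b} → a ^ n ≤ b ^ n → a ≤ b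
^-cancelˡ-≤ n aⁿ≤bⁿ = ≮⇒≥ λ b<a → <⇒≱ (^-monoˡ-< n b<a) aⁿ≤bⁿ

-- (1 + 1/2j)^i ≤ 1 + i/j, cleared of denominators.
[1+2j]^i*j≤[2j]^i*[j+i] : ∀ j i → i ≤ j → suc (2 * j) ^ i * j ≤ (2 * j) ^ i * (j + i)
[1+2j]^i*j≤[2j]^i*[j+i] j zero    _   = ≤-reflexive (cong (1 *_) (sym (+-identityʳ j)))
[1+2j]^i*j≤[2j]^i*[j+i] j (suc i) i<j = begin
  suc (2 * j) * suc (2 * j) ^ i * j       ≡⟨ *-assoc (suc (2 * j)) (suc (2 * j) ^ i) j ⟩
  suc (2 * j) * (suc (2 * j) ^ i * j)     ≤⟨ *-monoʳ-≤ (suc (2 * j)) {suc (2 * j) ^ i * j} ([1+2j]^i*j≤[2j]^i*[j+i] j i (<⇒≤ i<j)) ⟩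
  suc (2 * j) * ((2 * j) ^ i * (j + i))   ≡⟨ e₁ j i ((2 * j) ^ i) ⟩
  -- As `i ≤ j`, the surplus `j + i` is at most `2 * j`, which is what raising `i` by one adds.
  (2 * j) ^ i * (2 * j * (j + i) + (j + i)) ≤⟨ *-monoʳ-≤ ((2 * j) ^ i) (+-monoʳ-≤ (2 * j * (j + i)) (+-monoʳ-≤ j (<⇒≤ i<j))) ⟩
  (2 * j) ^ i * (2 * j * (j + i) + (j + j)) ≡⟨ e₂ j i ((2 * j) ^ i) ⟩
  2 * j * (2 * j) ^ i * (j + suc i)       ∎
  where
  open ≤-Reasoning
  e₁ : ∀ j i p → suc (2 * j) * (p * (j + i)) ≡ p * (2 * j * (j + i) + (j + i))
  e₁ = solve-∀
  e₂ : ∀ j i p → p * (2 * j * (j + i) + (j + j)) ≡ 2 * j * p * (j + suc i)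
  e₂ = solve-∀

[1+2j]^j≤2*[2j]^j : ∀ j .{{_ : NonZero j}} → suc (2 * j) ^ j ≤ 2 * (2 * j) ^ j
[1+2j]^j≤2*[2j]^j j = *-cancelʳ-≤ _ _ j (begin
  suc (2 * j) ^ j * j   ≤⟨ [1+2j]^i*j≤[2j]^i*[j+i] j j ≤-refl ⟩
  (2 * j) ^ j * (j + j) ≡⟨ e j ((2 * j) ^ j) ⟩
  2 * (2 * j) ^ j * j   ∎)
  where
  open ≤-Reasoning
  e : ∀ j p → p * (j + j) ≡ 2 * p * j
  e = solve-∀

-- Counting `u`-element combinations.

combinations : ∀ u → List A → List (Vec A u)
combinations zero    xs       = [] ∷ []
combinations (suc u) []       = []
combinations (suc u) (x ∷ xs) = map (x ∷_) (combinations u xs) ++ combinations (suc u) xs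

∈-combinations : ∀ {u} (v : Vec A u) {xs} → toList v ⊑ xs → v ∈ combinations u xs
∈-combinations []       _              = here refl
∈-combinations (x ∷ v) (y ∷ʳ p)        = ∈-++⁺ʳ _ (∈-combinations (x ∷ v) p)
∈-combinations (x ∷ v) (refl ∷ p)      = ∈-++⁺ˡ (∈-map⁺ (x ∷_) (∈-combinations v p))

-- The u-th term of the binomial expansion of (1 + 1/m)^N is at most the whole sum.
length-combinations : ∀ m u (xs : List A) → length (combinations u xs) * m ^ length xs ≤ suc m ^ length xs * m ^ u
length-combinations m zero    xs       =
  ≤-trans (≤-reflexive (*-identityˡ _)) (≤-trans (^-monoˡ-≤ (length xs) (n≤1+n m)) (≤-reflexive (sym (*-identityʳ _))))
length-combinations m (suc u) []       = z≤n
length-combinations m (suc u) (x ∷ xs) = begin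
  length (map (x ∷_) cs ++ ds) * (m * m ^ n)      ≡⟨ cong (_* (m * m ^ n)) (trans (length-++ (map (x ∷_) cs)) (cong (_+ length ds) (length-map (x ∷_) cs))) ⟩
  (length cs + length ds) * (m * m ^ n)           ≡⟨ e₁ (length cs) (length ds) m (m ^ n) ⟩
  m * (length cs * m ^ n + length ds * m ^ n)     ≤⟨ *-monoʳ-≤ m (+-mono-≤ (length-combinations m u xs) (length-combinations m (suc u) xs)) ⟩
  m * (suc m ^ n * m ^ u + suc m ^ n * (m * m ^ u)) ≡⟨ e₂ m (suc m ^ n) (m ^ u) ⟩
  suc m * suc m ^ n * (m * m ^ u)                 ∎
  where
  open ≤-Reasoning
  n = length xs
  cs = combinations u xs
  ds = combinations (suc u) xs
  e₁ : ∀ a b m p → (a + b) * (m * p) ≡ m * (a * p + b * p)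
  e₁ = solve-∀
  e₂ : ∀ m p q → m * (p * q + p * (m * q)) ≡ suc m * p * (m * q)
  e₂ = solve-∀

-- At `m = 2 * j` the preceding estimate reads C(N, u) ≤ (1 + 1/m)^N m^u. Raising N to `j * v`
-- through the gap `d` makes the first factor at most the v-th power of (1 + 1/2j)^j ≤ 2.
length-combinations-≤ : ∀ j .{{_ : NonZero j}} v u (xs : List A) → length xs ≤ j * v →
                        length (combinations u xs) ≤ 2 ^ v * (2 * j) ^ u
length-combinations-≤ j@(suc j-1) v u xs N≤jv = *-cancelʳ-≤ _ _ (m ^ (j * v)) {{m^n≢0 m (j * v)}} (begin
  c * m ^ (j * v)                        ≡⟨ cong (λ e → c * m ^ e) (sym N+d) ⟩
  c * m ^ (N + d)                        ≡⟨ cong (c *_) (^-distribˡ-+-* m N d) ⟩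
  c * (m ^ N * m ^ d)                    ≡⟨ *-assoc c _ _ ⟨
  c * m ^ N * m ^ d                      ≤⟨ *-mono-≤ (length-combinations m u xs) (^-monoˡ-≤ d (n≤1+n m)) ⟩
  suc m ^ N * m ^ u * suc m ^ d          ≡⟨ e₁ (suc m ^ N) (m ^ u) (suc m ^ d) ⟩
  suc m ^ N * suc m ^ d * m ^ u          ≡⟨ cong (_* m ^ u) (sym (^-distribˡ-+-* (suc m) N d)) ⟩
  suc m ^ (N + d) * m ^ u                ≡⟨ cong (λ e → suc m ^ e * m ^ u) N+d ⟩
  suc m ^ (j * v) * m ^ u                ≡⟨ cong (_* m ^ u) (sym (^-*-assoc (suc m) j v)) ⟩
  (suc m ^ j) ^ v * m ^ u                ≤⟨ *-monoˡ-≤ (m ^ u) (^-monoˡ-≤ v ([1+2j]^j≤2*[2j]^j j)) ⟩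
  (2 * m ^ j) ^ v * m ^ u                ≡⟨ cong (_* m ^ u) (^-distribʳ-* v 2 (m ^ j)) ⟩
  2 ^ v * (m ^ j) ^ v * m ^ u            ≡⟨ cong (λ p → 2 ^ v * p * m ^ u) (^-*-assoc m j v) ⟩
  2 ^ v * m ^ (j * v) * m ^ u            ≡⟨ e₁ (2 ^ v) (m ^ (j * v)) (m ^ u) ⟩
  2 ^ v * m ^ u * m ^ (j * v)            ∎)
  where
  open ≤-Reasoning
  m = 2 * j
  N = length xs
  c = length (combinations u xs)
  d = j * v ∸ N
  N+d : N + d ≡ j * v
  N+d = m+[n∸m]≡n N≤jv
  e₁ : ∀ a b c → a * b * c ≡ a * c * b
  e₁ = solve-∀

-- Cyclic shifts and transversals of a grid.

module Shift (s : ℕ) .{{_ : NonZero s}} where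

  -- Addition modulo `s`. The first argument is a natural number so that `s ∸ toℕ σ`, which is `s`
  -- itself when σ = 0, can serve as the inverse shift.
  shift : ℕ → Fin s → Fin s
  shift a g = fromℕ< (m%n<n (a + toℕ g) s)

  toℕ-shift : ∀ a g → toℕ (shift a g) ≡ (a + toℕ g) % s
  toℕ-shift a g = toℕ-fromℕ< _

  shift-shift : ∀ a b g → a + b ≡ s → shift a (shift b g) ≡ g
  shift-shift a b g a+b≡s = toℕ-injective (begin
    toℕ (shift a (shift b g))        ≡⟨ toℕ-shift a _ ⟩
    (a + toℕ (shift b g)) % s        ≡⟨ cong (λ z → (a + z) % s) (toℕ-shift b g) ⟩
    (a + (b + toℕ g) % s) % s        ≡⟨ %-distribˡ-+ a _ s ⟩
    (a % s + (b + toℕ g) % s % s) % s ≡⟨ cong (λ z → (a % s + z) % s) (m%n%n≡m%n (b + toℕ g) s) ⟩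
    (a % s + (b + toℕ g) % s) % s    ≡⟨ %-distribˡ-+ a _ s ⟨
    (a + (b + toℕ g)) % s            ≡⟨ cong (_% s) (trans (sym (+-assoc a b _)) (trans (cong (_+ toℕ g) a+b≡s) (+-comm s _))) ⟩
    (toℕ g + s) % s                  ≡⟨ [m+n]%n≡m%n (toℕ g) s ⟩
    toℕ g % s                        ≡⟨ m<n⇒m%n≡m (toℕ<n g) ⟩
    toℕ g                            ∎)
    where open ≡-Reasoning

  shift-injective : ∀ (σ : Fin s) {g h} → shift (toℕ σ) g ≡ shift (toℕ σ) h → g ≡ h
  shift-injective σ {g} {h} eq = trans (sym (inv g)) (trans (cong (shift (s ∸ toℕ σ)) eq) (inv h))
    where
    inv : ∀ g → shift (s ∸ toℕ σ) (shift (toℕ σ) g) ≡ g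
    inv g = shift-shift (s ∸ toℕ σ) (toℕ σ) g (m∸n+n≡m (toℕ≤n σ))

  shift-comm : ∀ (σ g : Fin s) → shift (toℕ σ) g ≡ shift (toℕ g) σ
  shift-comm σ g = toℕ-injective (trans (toℕ-shift (toℕ σ) g) (trans (cong (_% s) (+-comm (toℕ σ) (toℕ g))) (sym (toℕ-shift (toℕ g) σ))))

  -- The shift is c - g modulo `s`; `shift-comm` exchanges the summands so that `shift-shift`
  -- cancels g.
  shift-transitive : ∀ (g c : Fin s) → ∃[ σ ] shift (toℕ σ) g ≡ c
  shift-transitive g c = shift (s ∸ toℕ g) c , trans (shift-comm _ g) (shift-shift (toℕ g) (s ∸ toℕ g) c (m+[n∸m]≡n (toℕ≤n g)))

toList-take-drop : ∀ m {n} (v : Vec A (m + n)) → toList v ≡ toList (Vec.take m v) ++ toList (Vec.drop m v)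
toList-take-drop m v = trans (cong toList (sym (Vec.take++drop≡id m v))) (Vec.toList-++ (Vec.take m v) (Vec.drop m v))

∈-toList-lookup : ∀ {n} (v : Vec A n) {x} → x ∈ toList v → ∃[ i ] Vec.lookup v i ≡ x
∈-toList-lookup v x∈v = VecAny.index x∈ , sym (VecAny.lookup-index x∈)
  where x∈ = ∈-toList⁻ x∈v

fromList-unique : ∀ {xs : List A} → Unique xs → VecUnique (Vec.fromList xs)
fromList-unique []       = []
fromList-unique (p ∷ ps) = fromList⁺ p ∷ fromList-unique ps

asVec : ∀ {n} (xs : List A) → length xs ≡ n → Unique xs → ∃[ v ] toList {n = n} v ≡ xs × VecUnique v
asVec xs refl xs! = Vec.fromList xs , Vec.toList∘fromList xs , fromList-unique xs!

-- A vector of length u * s is read as a grid with u rows of length s.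
transversal : ∀ {s} u → Vec A (u * s) → (Fin u → Fin s) → Vec A u
transversal         zero    v f = []
transversal {s = s} (suc u) v f = Vec.lookup (Vec.take s v) (f zero) ∷ transversal u (Vec.drop s v) (f ∘ suc)

transversal-⊑ : ∀ {s} u (v : Vec A (u * s)) f → toList (transversal u v f) ⊑ toList v
transversal-⊑         zero    v f = minimum _
transversal-⊑ {s = s} (suc u) v f = subst (toList (transversal (suc u) v f) ⊑_) (sym (toList-take-drop s v))
  (⊑-++⁺ (from∈ (∈-toList⁺ (∈-lookup (f zero) (Vec.take s v)))) (transversal-⊑ u (Vec.drop s v) (f ∘ suc)))

transversal-injective : ∀ {s} u {v : Vec A (u * s)} {f g} → VecUnique v →
                        transversal u v f ≡ transversal u v g → f ≗ g
transversal-injective {s = s} (suc u) v! eq zero    =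
  VecUnique.lookup-injective (VecUnique.take⁺ s v!) _ _ (Vec.∷-injectiveˡ eq)
transversal-injective {s = s} (suc u) v! eq (suc r) =
  transversal-injective u (VecUnique.drop⁺ s v!) (Vec.∷-injectiveʳ eq) r

module _ {s} .{{_ : NonZero s}} where
  open Shift s

  -- Only the row of `x` matters: one shift carries the column that `g` picks in that row to the
  -- column of `x`. Hence any starting `g` works.
  shifted-transversals-cover : ∀ u (v : Vec A (u * s)) (g : Fin u → Fin s) {x} → x ∈ toList v →
    ∃[ σ ] x ∈ toList (transversal u v (shift (toℕ {s} σ) ∘ g))
  shifted-transversals-cover zero    [] g ()
  shifted-transversals-cover (suc u) v  g x∈v
    with ∈-++⁻ (toList (Vec.take s v)) (subst (_ ∈_) (toList-take-drop s v) x∈v)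
  ... | inj₂ x∈d with shifted-transversals-cover u (Vec.drop s v) (g ∘ suc) x∈d
  ...   | σ , x∈t = σ , there x∈t
  shifted-transversals-cover (suc u) v  g x∈v
      | inj₁ x∈t with ∈-toList-lookup (Vec.take s v) x∈t
  ...   | c , refl with shift-transitive (g zero) c
  ...     | σ , refl = σ , here refl

-- Counting and arithmetic for the cover-free bound.

length-filter-∁ : ∀ {P : A → Set} (P? : Decidable P) xs →
                  length (filter P? xs) + length (filter (¬? ∘ P?) xs) ≡ length xs
length-filter-∁ P? []       = refl
length-filter-∁ P? (x ∷ xs) with P? x
... | yes _ = cong suc (length-filter-∁ P? xs)
... | no  _ = trans (+-suc _ _) (cong suc (length-filter-∁ P? xs))

funToFin-cong : ∀ {m n} {f g : Fin m → Fin n} → f ≗ g → funToFin f ≡ funToFin g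
funToFin-cong {zero}  f≗g = refl
funToFin-cong {suc m} f≗g = cong₂ combine (f≗g zero) (funToFin-cong (f≗g ∘ suc))

-- The hypothesis is what counting private transversals yields after `length-combinations-≤` at
-- `j = s * s`, `v = 2 * u`. Since 4^u (2s²)^u = (8s)^u s^u, a factor s^u cancels.
m*s^u≤[8s²]^u*s⇒m≤s*[8s]^u : ∀ s .{{_ : NonZero s}} u m → m * s ^ u ≤ 2 ^ (2 * u) * (2 * (s * s)) ^ u * s → m ≤ s * (8 * s) ^ u
m*s^u≤[8s²]^u*s⇒m≤s*[8s]^u s u m h = *-cancelʳ-≤ m _ (s ^ u) {{m^n≢0 s u}} (begin
  m * s ^ u                              ≤⟨ h ⟩
  2 ^ (2 * u) * (2 * (s * s)) ^ u * s    ≡⟨ cong (λ p → p * (2 * (s * s)) ^ u * s) (sym (^-*-assoc 2 2 u)) ⟩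
  4 ^ u * (2 * (s * s)) ^ u * s          ≡⟨ cong (_* s) (sym (^-distribʳ-* u 4 (2 * (s * s)))) ⟩
  (4 * (2 * (s * s))) ^ u * s            ≡⟨ cong (λ p → p ^ u * s) (e₁ s) ⟩
  (8 * s * s) ^ u * s                    ≡⟨ cong (_* s) (^-distribʳ-* u (8 * s) s) ⟩
  (8 * s) ^ u * s ^ u * s                ≡⟨ e₂ ((8 * s) ^ u) (s ^ u) s ⟩
  s * (8 * s) ^ u * s ^ u                ∎)
  where
  open ≤-Reasoning
  e₁ : ∀ s → 4 * (2 * (s * s)) ≡ 8 * s * s
  e₁ = solve-∀
  e₂ : ∀ a b c → a * b * c ≡ c * a * b
  e₂ = solve-∀

-- A heavy set meets `a` points and misses `b`. With s = 2 + r, taking away a share of at least 2/s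
-- leaves at most (s - 2)/s.
heavy⇒residual-≤ : ∀ a b r → 2 * (a + b) ≤ a * (2 + r) → b * (2 + r) ≤ (a + b) * r
heavy⇒residual-≤ a b r h = +-cancelˡ-≤ (2 * (a + b)) _ _ (begin
  2 * (a + b) + b * (2 + r)    ≤⟨ +-monoˡ-≤ (b * (2 + r)) h ⟩
  a * (2 + r) + b * (2 + r)    ≡⟨ e a b r ⟩
  2 * (a + b) + (a + b) * r    ∎)
  where
  open ≤-Reasoning
  e : ∀ a b r → a * (2 + r) + b * (2 + r) ≡ 2 * (a + b) + (a + b) * r
  e = solve-∀

-- With s = 3 + r, dividing d′ ≤ d(s - 2)/s by (s - 1)(s - 2) gives d′/((s - 1)(s - 2)) ≤ d/(s(s -
-- 1)). So a `u` admissible after a deletion was admissible before it.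
delete-heavy-≤ : ∀ u d d′ r → u * ((2 + r) * (1 + r)) ≤ 2 * d′ → d′ * (3 + r) ≤ d * (1 + r) → u * ((3 + r) * (2 + r)) ≤ 2 * d
delete-heavy-≤ u d d′ r u≤ d′≤ = *-cancelʳ-≤ (u * ((3 + r) * (2 + r))) (2 * d) (1 + r) (begin
  u * ((3 + r) * (2 + r)) * (1 + r)   ≡⟨ e u (1 + r) (2 + r) (3 + r) ⟩
  u * ((2 + r) * (1 + r)) * (3 + r)   ≤⟨ *-monoˡ-≤ (3 + r) u≤ ⟩
  2 * d′ * (3 + r)                    ≡⟨ *-assoc 2 d′ (3 + r) ⟩
  2 * (d′ * (3 + r))                  ≤⟨ *-monoʳ-≤ 2 d′≤ ⟩
  2 * (d * (1 + r))                   ≡⟨ *-assoc 2 d (1 + r) ⟨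
  2 * d * (1 + r)                     ∎)
  where
  open ≤-Reasoning
  e : ∀ u a b c → u * (c * b) * a ≡ u * (b * a) * c
  e = solve-∀

-- The summand `s` pays for the deleted sets, at most one per value of s. The exponent is `suc u`
-- because `u` is a quotient rounded down, while the grid needs one row more.
bound : ℕ → ℕ → ℕ
bound s u = s + s * (8 * s) ^ suc u

light⇒≤bound : ∀ s u {m} → m ≤ s * (8 * s) ^ suc u → m ≤ bound s u
light⇒≤bound s u h = ≤-trans h (m≤n+m _ s)

n≤bound : ∀ s u → s ≤ bound s u
n≤bound s u = m≤m+n s _

bound-suc : ∀ s u → suc (bound s u) ≤ bound (suc s) u
bound-suc s u = s≤s (+-monoʳ-≤ s (*-mono-≤ (n≤1+n s) (^-monoˡ-≤ (suc u) (*-monoʳ-≤ 8 (n≤1+n s)))))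

-- The leading `suc` accounts for the base codeword; one extra factor `8 * t` absorbs both summands.
1+bound≤[8t]^[2+u] : ∀ s t .{{_ : NonZero t}} u → s < t → suc (bound s u) ≤ (8 * t) ^ (2 + u)
1+bound≤[8t]^[2+u] s t u s<t = begin
  suc s + s * (8 * s) ^ suc u        ≤⟨ +-mono-≤ t≤t*p (*-mono-≤ (<⇒≤ s<t) (^-monoˡ-≤ (suc u) (*-monoʳ-≤ 8 (<⇒≤ s<t)))) ⟩
  t * p + t * p                      ≤⟨ m≤m+n (t * p + t * p) (6 * (t * p)) ⟩
  t * p + t * p + 6 * (t * p)        ≡⟨ e t p ⟩
  8 * t * p                          ∎
  where
  open ≤-Reasoning
  p = (8 * t) ^ suc u
  t≤t*p : suc s ≤ t * p
  t≤t*p = ≤-trans s<t (m≤m*n t p {{m^n≢0 (8 * t) (suc u) {{m*n≢0 8 t}}}})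
  e : ∀ t p → t * p + t * p + 6 * (t * p) ≡ 8 * t * p
  e = solve-∀

-- Cover-free families and their private transversals.

module CoverFree {W I : Set} (_≟ʷ_ : DecidableEquality W)
                 (_∋_ : W → I → Set) (_∋?_ : ∀ w i → Dec (w ∋ i)) where

  Covered : List I → W → List W → Set
  Covered D y X = ∀ {i} → i ∈ D → y ∋ i → Any (_∋ i) X

  -- Sets are seen only on `D`, so deleting points just shrinks `D`. `X` may have repetitions, as
  -- happens when its members are chosen shift by shift.
  IsCoverFree : ℕ → List W → List I → Set
  IsCoverFree s F D = ∀ {y} → y ∈ F → ∀ {X} → X ⊆ F → y ∉ X → length X ≤ s → ¬ Covered D y X

  trace : List I → W → List I
  trace D y = filter (y ∋?_) D

  module Transversals (s : ℕ) .{{_ : NonZero s}} (u : ℕ) (F : List W) (D : List I)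
    (F! : Unique F) (D! : Unique D) (cf : IsCoverFree s F D)
    (light : ∀ {y} → y ∈ F → length (trace D y) ≤ u * s) where

    open Shift s

    -- The right summand supplies `u * s` dummy points, enough to pad any light set to a full grid.
    ground : List (I ⊎ ℕ)
    ground = map inj₁ D ++ map inj₂ (upTo (u * s))

    length-ground : length ground ≡ length D + u * s
    length-ground = trans (length-++ (map inj₁ D))
      (cong₂ _+_ (length-map inj₁ D) (trans (length-map inj₂ (upTo (u * s))) (length-upTo (u * s))))

    padded : W → List (I ⊎ ℕ)
    padded y = map inj₁ (trace D y) ++ map inj₂ (drop (length (trace D y)) (upTo (u * s)))

    padded-⊑ : ∀ y → padded y ⊑ ground
    padded-⊑ y = ⊑-++⁺ (⊑-map⁺ inj₁ (filter-⊑ (y ∋?_) D)) (⊑-map⁺ inj₂ (drop-⊑ (length (trace D y)) (upTo (u * s))))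

    padded-unique : ∀ y → Unique (padded y)
    padded-unique y = Unique.++⁺ (Unique.map⁺ inj₁-injective (Unique.filter⁺ (y ∋?_) D!))
                                 (Unique.map⁺ inj₂-injective (Unique.drop⁺ (length (trace D y)) (Unique.upTo⁺ (u * s))))
                                 disjoint
      where
      disjoint : ∀ {x} → ¬ (x ∈ map inj₁ (trace D y) × x ∈ map inj₂ (drop (length (trace D y)) (upTo (u * s))))
      disjoint (p , q) with ∈-map⁻ inj₁ p | ∈-map⁻ inj₂ q
      ... | _ , _ , refl | _ , _ , ()

    length-padded : ∀ {y} → y ∈ F → length (padded y) ≡ u * s
    length-padded {y} y∈F = begin
      length (padded y)                         ≡⟨ length-++ (map inj₁ (trace D y)) ⟩
      length (map inj₁ (trace D y)) + length (map inj₂ (drop a (upTo (u * s)))) ≡⟨ cong₂ _+_ (length-map inj₁ (trace D y)) (length-map inj₂ (drop a (upTo (u * s)))) ⟩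
      a + length (drop a (upTo (u * s)))        ≡⟨ cong (a +_) (length-drop a (upTo (u * s))) ⟩
      a + (length (upTo (u * s)) ∸ a)           ≡⟨ cong (λ l → a + (l ∸ a)) (length-upTo (u * s)) ⟩
      a + (u * s ∸ a)                           ≡⟨ m+[n∸m]≡n (light y∈F) ⟩
      u * s                                     ∎
      where
      open ≡-Reasoning
      a = length (trace D y)

    word : Fin (length F) → W
    word = Vec.lookup (Vec.fromList F)

    word∈F : ∀ j → word j ∈ F
    word∈F j = ∈-fromList⁻ (∈-lookup j (Vec.fromList F))

    gridOf : ∀ j → ∃[ v ] toList {n = u * s} v ≡ padded (word j) × VecUnique v
    gridOf j = asVec (padded (word j)) (length-padded (word∈F j)) (padded-unique (word j))

    grid : Fin (length F) → Vec (I ⊎ ℕ) (u * s)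
    grid j = proj₁ (gridOf j)

    -- Dummy points belong to every set, so a transversal is private exactly when no other set
    -- contains all its genuine points.
    Contains : W → I ⊎ ℕ → Set
    Contains z = [ z ∋_ , (λ _ → ⊤) ]

    contains? : ∀ z x → Dec (Contains z x)
    contains? z (inj₁ i) = z ∋? i
    contains? z (inj₂ _) = yes tt

    padded-contains : ∀ y → All (Contains y) (padded y)
    padded-contains y = All.++⁺ (All.map⁺ (All.all-filter (y ∋?_) D)) (All.map⁺ (All.universal (λ _ → tt) _))

    Shared : W → List (I ⊎ ℕ) → Set
    Shared y T = Any (λ z → z ≢ y × All (Contains z) T) F

    shared? : ∀ y T → Dec (Shared y T)
    shared? y T = Any.any? (λ z → ¬? (z ≟ʷ y) ×-dec All.all? (contains? z) T) F

    pick : Fin (length F) → (Fin u → Fin s) → Fin s → Vec (I ⊎ ℕ) u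
    pick j g σ = transversal u (grid j) (shift (toℕ σ) ∘ g)

    -- The s shifts of a transversal cover the whole grid, so s other sets containing
    -- one of them each would cover the set itself.
    ¬all-shared : ∀ j g → ¬ (∀ σ → Shared (word j) (toList (pick j g σ)))
    ¬all-shared j g shared = cf (word∈F j) X⊆F y∉X (≤-reflexive (length-tabulate other)) covered
      where
      other : Fin s → W
      other σ = proj₁ (find (shared σ))
      X⊆F : tabulate other ⊆ F
      X⊆F x∈X with ∈-tabulate⁻ x∈X
      ... | σ , refl = proj₁ (proj₂ (find (shared σ)))
      y∉X : word j ∉ tabulate other
      y∉X y∈X with ∈-tabulate⁻ y∈X
      ... | σ , eq = proj₁ (proj₂ (proj₂ (find (shared σ)))) (sym eq)
      covered : Covered D (word j) (tabulate other)
      covered {i} i∈D y∋i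
        with shifted-transversals-cover u (grid j) g
               (subst (inj₁ i ∈_) (sym (proj₁ (proj₂ (gridOf j)))) (∈-++⁺ˡ (∈-map⁺ inj₁ (∈-filter⁺ (word j ∋?_) i∈D y∋i))))
      ... | σ , i∈T = lose (∈-tabulate⁺ σ) (All.lookup (proj₂ (proj₂ (proj₂ (find (shared σ))))) i∈T)

    ownShift : ∀ j g → ∃[ σ ] ¬ Shared (word j) (toList (pick j g σ))
    ownShift j g = ¬∀⟶∃¬ s _ (λ σ → shared? (word j) (toList (pick j g σ))) (¬all-shared j g)

    own : Fin (length F) → (Fin u → Fin s) → Vec (I ⊎ ℕ) u
    own j g = pick j g (proj₁ (ownShift j g))

    own-contains : ∀ j g → All (Contains (word j)) (toList (own j g))
    own-contains j g = All.tabulate λ x∈T →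
      All.lookup (padded-contains (word j)) (subst (_ ∈_) (proj₁ (proj₂ (gridOf j))) (⊑-lookup (transversal-⊑ u (grid j) _) x∈T))

    own∈combinations : ∀ j g → own j g ∈ combinations u ground
    own∈combinations j g = ∈-combinations (own j g)
      (⊑-trans (transversal-⊑ u (grid j) _) (⊑-trans (⊑-reflexive (proj₁ (proj₂ (gridOf j)))) (padded-⊑ (word j))))

    -- If the words differed, `word j` would be another set containing the private transversal of
    -- `word k`.
    own-injectiveˡ : ∀ {j k g h} → own j g ≡ own k h → j ≡ k
    own-injectiveˡ {j} {k} {g} {h} eq = VecUnique.lookup-injective (fromList-unique F!) j k
      (decidable-stable (word j ≟ʷ word k) λ j≢k →
        proj₂ (ownShift k h) (lose (word∈F j) (j≢k , subst (All (Contains (word j)) ∘ toList) eq (own-contains j g))))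

    -- For a known shift both steps can be undone: the grid has distinct entries, and shifting is
    -- injective.
    own-injectiveʳ : ∀ {j g h} → proj₁ (ownShift j g) ≡ proj₁ (ownShift j h) → own j g ≡ own j h → g ≗ h
    own-injectiveʳ {j} {g} {h} σ≡τ eq r = shift-injective (proj₁ (ownShift j g))
      (trans (transversal-injective u (proj₂ (proj₂ (gridOf j))) eq r) (cong (λ τ → shift (toℕ τ) (h r)) (sym σ≡τ)))

    -- The shift is recorded because the transversal alone determines `g` only up to a shift; this
    -- costs the factor `s`.
    encode : Fin (length F) × Fin (s ^ u) → Fin (length (combinations u ground) * s)
    encode (j , e) = combine (Any.index (own∈combinations j g)) (proj₁ (ownShift j g))
      where g = finToFun e

    encode-injective : ∀ {p q} → encode p ≡ encode q → p ≡ q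
    encode-injective {j , e} {k , f} eq with combine-injective _ _ _ _ eq
    ... | idx≡ , σ≡ = go (own-injectiveˡ own≡) own≡ σ≡
      where
      g = finToFun e
      h = finToFun f
      own≡ : own j g ≡ own k h
      own≡ = trans (lookup-index (own∈combinations j g))
        (trans (cong (List.lookup (combinations u ground)) idx≡) (sym (lookup-index (own∈combinations k h))))
      go : j ≡ k → own j g ≡ own k h → proj₁ (ownShift j g) ≡ proj₁ (ownShift k h) → (j , e) ≡ (k , f)
      go refl own≡ σ≡ = cong (j ,_) (trans (sym (funToFin-finToFin {u} {s} e))
        (trans (funToFin-cong (own-injectiveʳ σ≡ own≡)) (funToFin-finToFin {u} {s} f)))

    length*s^u≤combinations*s : length F * s ^ u ≤ length (combinations u ground) * s
    length*s^u≤combinations*s = injective⇒≤ {f = encode ∘ remQuot {length F} (s ^ u)} λ {x} {y} eq →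
      trans (sym (combine-remQuot {length F} (s ^ u) x)) (trans (cong (uncurry combine) (encode-injective eq)) (combine-remQuot {length F} (s ^ u) y))

  light-bound : ∀ s .{{_ : NonZero s}} F D → Unique F → Unique D → IsCoverFree s F D →
                (∀ {y} → y ∈ F → length (trace D y) * s < 2 * length D) →
                ∃[ u ] u * (s * s) ≤ 2 * length D × length F ≤ bound s u
  light-bound s {{s≢0}} F D F! D! cf light = u₀ , m/n*n≤m (2 * d) (s * s) ,
    light⇒≤bound s u₀ (m*s^u≤[8s²]^u*s⇒m≤s*[8s]^u s u (length F) (≤-trans length*s^u≤combinations*s
      (*-monoˡ-≤ s (length-combinations-≤ (s * s) (2 * u) u ground ground≤))))
    where
    open ≤-Reasoning
    instance
      s²≢0 : NonZero (s * s)
      s²≢0 = m*n≢0 s s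
    d = length D
    -- Rounding down gives the first half of the conclusion; the extra row in `u` gives the strict
    -- `2d<us²`, so that light traces fit into `u * s` points.
    u₀ = 2 * d / (s * s)
    u = suc u₀
    2d<us² : 2 * d < u * (s * s)
    2d<us² = begin-strict
      2 * d                                  ≡⟨ m≡m%n+[m/n]*n (2 * d) (s * s) ⟩
      2 * d % (s * s) + u₀ * (s * s)         <⟨ +-monoˡ-< (u₀ * (s * s)) (m%n<n (2 * d) (s * s)) ⟩
      u * (s * s)                            ∎
    light′ : ∀ {y} → y ∈ F → length (trace D y) ≤ u * s
    light′ {y} y∈F = <⇒≤ (*-cancelʳ-< s (length (trace D y)) (u * s)
      (<-trans (light y∈F) (<-≤-trans 2d<us² (≤-reflexive (sym (*-assoc u s s))))))
    open Transversals s u F D F! D! cf light′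
    ground≤ : length ground ≤ s * s * (2 * u)
    ground≤ = begin
      length ground               ≡⟨ length-ground ⟩
      -- Both summands are at most us², which yields the form `j * v` with `j = s * s` and
      -- `v = 2 * u`.
      d + u * s                   ≤⟨ +-mono-≤ (≤-trans (m≤n*m d 2) (<⇒≤ 2d<us²)) (*-monoʳ-≤ u (m≤m*n s s)) ⟩
      u * (s * s) + u * (s * s)   ≡⟨ e u (s * s) ⟩
      s * s * (2 * u)             ∎
      where
      e : ∀ u m → u * m + u * m ≡ m * (2 * u)
      e = solve-∀

  -- Deleting heavy sets.

  residual : List I → W → List I
  residual D y = filter (¬? ∘ (y ∋?_)) D

  -- A cover of `z` by `X` on the residual points becomes a cover by `y ∷ X` on `D`, as `y` takes
  -- care of the deleted points; `y ∉ F′` keeps `z` apart from `y`.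
  residual-coverFree : ∀ {s y F F′ D} → IsCoverFree (suc s) F D → y ∈ F → F′ ⊆ F → y ∉ F′ →
                       IsCoverFree s F′ (residual D y)
  residual-coverFree {y = y} {F} {D = D} cf y∈F F′⊆F y∉F′ {z} z∈F′ {X} X⊆F′ z∉X |X|≤s covered =
    cf (F′⊆F z∈F′) y∷X⊆F z∉y∷X (s≤s |X|≤s) covered′
    where
    y∷X⊆F : (y ∷ X) ⊆ F
    y∷X⊆F (here refl) = y∈F
    y∷X⊆F (there x∈X) = F′⊆F (X⊆F′ x∈X)
    z∉y∷X : z ∉ y ∷ X
    z∉y∷X (here refl)  = y∉F′ z∈F′
    z∉y∷X (there z∈X) = z∉X z∈X
    covered′ : Covered D z (y ∷ X)
    covered′ {i} i∈D z∋i with y ∋? i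
    ... | yes y∋i = here y∋i
    ... | no  y∌i = there (covered (∈-filter⁺ (¬? ∘ (y ∋?_)) i∈D y∌i) z∋i)

  -- With no points, the empty subfamily covers any member vacuously.
  coverFree-[] : ∀ {s F} → IsCoverFree s F [] → length F ≡ 0
  coverFree-[] {F = []}    cf = refl
  coverFree-[] {F = y ∷ F} cf = contradiction (λ ()) (cf (here refl) {[]} (λ ()) (λ ()) z≤n)

  heavy-residual-≤ : ∀ r D y → 2 * length D ≤ length (trace D y) * (2 + r) →
                     length (residual D y) * (2 + r) ≤ length D * r
  heavy-residual-≤ r D y heavy = subst (λ d → b * (2 + r) ≤ d * r) |D|
    (heavy⇒residual-≤ a b r (subst (λ d → 2 * d ≤ a * (2 + r)) (sym |D|) heavy))
    where
    a = length (trace D y)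
    b = length (residual D y)
    |D| : a + b ≡ length D
    |D| = length-filter-∁ (y ∋?_) D

  Heavy : ℕ → List I → W → Set
  Heavy s D y = 2 * length D ≤ length (trace D y) * s

  record Reduction (r : ℕ) (F : List W) (D : List I) : Set where
    field
      y         : W
      F′        : List W
      F′!       : Unique F′
      coverFree : IsCoverFree (1 + r) F′ (residual D y)
      D′≤       : length (residual D y) * (2 + r) ≤ length D * r
      |F|       : length F ≡ suc (length F′)

  reduce : ∀ r {F D} → Any (Heavy (2 + r) D) F → Unique F → IsCoverFree (2 + r) F D → Reduction r F D
  reduce r {F} {D} heavy F! cf with find heavy
  ... | y , y∈F , y-heavy with ∈-∃++ y∈F
  ...   | xs , ys , refl = record
    { y         = y
    ; F′        = xs ++ ys
    ; F′!       = AllPairs.tail yF′!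
    ; coverFree = residual-coverFree cf y∈F (∈-resp-↭ (↭-sym F↭) ∘ there) (Unique.Unique[x∷xs]⇒x∉xs yF′!)
    ; D′≤       = heavy-residual-≤ r D y y-heavy
    ; |F|       = ↭-length F↭
    }
    where
    F↭ : F ↭ y ∷ xs ++ ys
    F↭ = ↭-shift y xs ys
    yF′! : Unique (y ∷ xs ++ ys)
    yF′! = ↭ₛ.Unique-resp-↭ (setoid W) (↭⇒↭ₛ F↭) F!

  -- With s = 2 + r the denominator is s(s - 1), weaker than the s² of `light-bound`: passing to s -
  -- 1 multiplies it by (s - 2)/s, exactly the guaranteed shrinkage of `D`.
  Bounded : ℕ → List W → List I → Set
  Bounded r F D = ∃[ u ] u * ((2 + r) * (1 + r)) ≤ 2 * length D × length F ≤ bound (2 + r) u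

  light⇒bounded : ∀ r F D → Unique F → Unique D → IsCoverFree (2 + r) F D →
                  ¬ Any (Heavy (2 + r) D) F → Bounded r F D
  light⇒bounded r F D F! D! cf ¬heavy =
    weaken (light-bound (2 + r) F D F! D! cf (λ y∈F → ≰⇒> λ h → ¬heavy (lose y∈F h)))
    where
    weaken : ∃[ u ] u * ((2 + r) * (2 + r)) ≤ 2 * length D × length F ≤ bound (2 + r) u → Bounded r F D
    weaken (u , us²≤2d , |F|≤) = u , ≤-trans (*-monoʳ-≤ u (*-monoʳ-≤ (2 + r) (n≤1+n (1 + r)))) us²≤2d , |F|≤

  coverFree-bound : ∀ r F D → Unique F → Unique D → IsCoverFree (2 + r) F D → Bounded r F D
  coverFree-bound r F D F! D! cf with Any.any? (λ y → 2 * length D ≤? length (trace D y) * (2 + r)) F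
  coverFree-bound r F D F! D! cf | no ¬heavy = light⇒bounded r F D F! D! cf ¬heavy
  -- For s = 2 a heavy set contains all of `D`. No points remain, so `F′` is empty and `F` is a
  -- singleton.
  coverFree-bound zero F D F! D! cf | yes heavy = 0 , z≤n , (begin
    length F          ≡⟨ |F| ⟩
    suc (length F′)   ≡⟨ cong suc (coverFree-[] (subst (IsCoverFree 1 F′) (empty (residual D y) D′≤) coverFree)) ⟩
    1                 ≤⟨ n≤1+n 1 ⟩
    2                 ≤⟨ n≤bound 2 0 ⟩
    bound 2 0         ∎)
    where
    open ≤-Reasoning
    open Reduction (reduce 0 heavy F! cf)
    empty : ∀ (D′ : List I) → length D′ * 2 ≤ length D * 0 → D′ ≡ []
    empty []      _ = refl
    empty (_ ∷ _) p = contradiction (≤-trans p (≤-reflexive (*-zeroʳ (length D)))) λ ()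
  coverFree-bound (suc r) F D F! D! cf | yes heavy
    with coverFree-bound r F′ (residual D y) F′! (Unique.filter⁺ (¬? ∘ (y ∋?_)) D!) coverFree
    where open Reduction (reduce (suc r) heavy F! cf)
  -- The same `u` is kept; the deleted set is the one unit gained in `bound-suc`.
  ... | u , u≤ , F′≤ = u , delete-heavy-≤ u (length D) (length (residual D y)) r u≤ D′≤ ,
      ≤-trans (≤-reflexive |F|) (≤-trans (s≤s F′≤) (bound-suc (2 + r) u))
    where open Reduction (reduce (suc r) heavy F! cf)

-- Passing to the asymptotic exponent.

-- For t = 3 + r, t² exceeds (t - 1)(t - 2) by 3t - 2, so 3(a + 1)t ≤ t² suffices.
at²≤[1+a][t-1][t-2] : ∀ a r → 3 * suc a ≤ 3 + r → a * ((3 + r) * (3 + r)) ≤ suc a * ((2 + r) * (1 + r))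
at²≤[1+a][t-1][t-2] a r t≥ = +-cancelʳ-≤ (3 * suc a * (3 + r)) _ _ (begin
  a * ((3 + r) * (3 + r)) + 3 * suc a * (3 + r)             ≤⟨ +-monoʳ-≤ (a * ((3 + r) * (3 + r))) (*-monoˡ-≤ (3 + r) t≥) ⟩
  a * ((3 + r) * (3 + r)) + (3 + r) * (3 + r)               ≤⟨ m≤m+n _ (2 * suc a) ⟩
  a * ((3 + r) * (3 + r)) + (3 + r) * (3 + r) + 2 * suc a   ≡⟨ e a r ⟩
  suc a * ((2 + r) * (1 + r)) + 3 * suc a * (3 + r)         ∎)
  where
  open ≤-Reasoning
  e : ∀ a r → a * ((3 + r) * (3 + r)) + (3 + r) * (3 + r) + 2 * suc a ≡ suc a * ((2 + r) * (1 + r)) + 3 * suc a * (3 + r)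
  e = solve-∀

-- At a = 8k the right side exceeds 2ka²n by a²n = 8akn, while the left side exceeds it by only 6akn
-- + 2kn.
8k-slack : ∀ k .{{_ : NonZero k}} n →
           suc (8 * k) * suc (8 * k) * k * (2 * n) + 2 * (8 * k) * k * n ≤ 8 * k * ((2 * k + 1) * n * (8 * k))
8k-slack k n = +-cancelʳ-≤ (16 * (k * (k * n))) _ _ (begin
  suc (8 * k) * suc (8 * k) * k * (2 * n) + 2 * (8 * k) * k * n + 16 * (k * (k * n)) ≡⟨ e k n ⟩
  8 * k * ((2 * k + 1) * n * (8 * k)) + 2 * (k * n)                                  ≤⟨ +-monoʳ-≤ (8 * k * ((2 * k + 1) * n * (8 * k))) 2kn≤16k²n ⟩
  8 * k * ((2 * k + 1) * n * (8 * k)) + 16 * (k * (k * n))                           ∎)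
  where
  open ≤-Reasoning
  2kn≤16k²n : 2 * (k * n) ≤ 16 * (k * (k * n))
  2kn≤16k²n = *-mono-≤ (m≤m+n 2 14) (m≤n*m (k * n) k)
  e : ∀ k n → suc (8 * k) * suc (8 * k) * k * (2 * n) + 2 * (8 * k) * k * n + 16 * (k * (k * n))
            ≡ 8 * k * ((2 * k + 1) * n * (8 * k)) + 2 * (k * n)
  e = solve-∀

-- Three losses must fit into the allowance 1/k: the exponent 1 + 1/a from 8t ≤ t^(1 + 1/a), the
-- ratio t²/P ≤ 1 + 1/a, and the additive 2 in `2 + u`, which is small against `n` once n ≥ (a +
-- 1)t².
exponent-≤ : ∀ k .{{_ : NonZero k}} a t² P u n → a ≡ 8 * k → a * t² ≤ suc a * P → u * P ≤ 2 * n → suc a * t² ≤ n →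
             suc a * ((2 + u) * (k * t²)) ≤ (2 * k + 1) * n * a
exponent-≤ k a t² P u n refl at²≤ uP≤ n≥ = *-cancelˡ-≤ a {{m*n≢0 8 k}} (begin
  a * (suc a * ((2 + u) * (k * t²)))                    ≡⟨ e₁ a k u t² ⟩
  suc a * k * (u * (a * t²)) + 2 * a * k * (suc a * t²) ≤⟨ +-mono-≤ (*-monoʳ-≤ (suc a * k) (*-monoʳ-≤ u at²≤)) (*-monoʳ-≤ (2 * a * k) n≥) ⟩
  suc a * k * (u * (suc a * P)) + 2 * a * k * n         ≡⟨ e₂ a k u P n ⟩
  suc a * suc a * k * (u * P) + 2 * a * k * n           ≤⟨ +-monoˡ-≤ (2 * a * k * n) (*-monoʳ-≤ (suc a * suc a * k) uP≤) ⟩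
  suc a * suc a * k * (2 * n) + 2 * a * k * n           ≤⟨ 8k-slack k n ⟩
  a * ((2 * k + 1) * n * a)                             ∎)
  where
  open ≤-Reasoning
  e₁ : ∀ a k u q → a * (suc a * ((2 + u) * (k * q))) ≡ suc a * k * (u * (a * q)) + 2 * a * k * (suc a * q)
  e₁ = solve-∀
  e₂ : ∀ a k u p n → suc a * k * (u * (suc a * p)) + 2 * a * k * n ≡ suc a * suc a * k * (u * p) + 2 * a * k * n
  e₂ = solve-∀

-- If 8^a ≤ t then 8t ≤ t^(1 + 1/a).
power-≤ : ∀ a .{{_ : NonZero a}} t .{{_ : NonZero t}} m v e f → 8 ^ a ≤ t → m ≤ (8 * t) ^ v → suc a * (v * e) ≤ f * a →
          m ^ e ≤ t ^ f
power-≤ a t m v e f 8ᵃ≤t m≤ exp≤ = ^-cancelˡ-≤ a (begin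
  (m ^ e) ^ a                  ≤⟨ ^-monoˡ-≤ a (^-monoˡ-≤ e m≤) ⟩
  (((8 * t) ^ v) ^ e) ^ a      ≡⟨ cong (_^ a) (^-*-assoc (8 * t) v e) ⟩
  ((8 * t) ^ (v * e)) ^ a      ≡⟨ ^-*-assoc (8 * t) (v * e) a ⟩
  (8 * t) ^ (v * e * a)        ≡⟨ cong ((8 * t) ^_) (*-comm (v * e) a) ⟩
  (8 * t) ^ (a * (v * e))      ≡⟨ ^-*-assoc (8 * t) a (v * e) ⟨
  ((8 * t) ^ a) ^ (v * e)      ≡⟨ cong (_^ (v * e)) (^-distribʳ-* a 8 t) ⟩
  (8 ^ a * t ^ a) ^ (v * e)    ≤⟨ ^-monoˡ-≤ (v * e) (*-monoˡ-≤ (t ^ a) 8ᵃ≤t) ⟩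
  (t ^ suc a) ^ (v * e)        ≡⟨ ^-*-assoc t (suc a) (v * e) ⟩
  t ^ (suc a * (v * e))        ≤⟨ ^-monoʳ-≤ t exp≤ ⟩
  t ^ (f * a)                  ≡⟨ ^-*-assoc t f a ⟨
  (t ^ f) ^ a                  ∎)
  where open ≤-Reasoning

-- From frameproof codes to cover-free families.

module _ {q n : ℕ} where

  _≟ʷ_ : DecidableEquality (Word q n)
  _≟ʷ_ = Vec.≡-dec _≟_

  module Differences (c₀ : Word q n) where

    DiffersAt : Word q n → Fin n → Set
    DiffersAt c i = lookup c i ≢ lookup c₀ i

    open CoverFree _≟ʷ_ DiffersAt (λ c i → ¬? (lookup c i ≟ lookup c₀ i)) public

    -- The position set where y differs from c₀ is covered by those of X exactly when
    -- y agrees with c₀ on every undetectable position of X ∪ {c₀}.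
    differences-coverFree : ∀ {s F} → WideSenseFrameproof (suc s) (c₀ ∷ F) → IsCoverFree s F (allFin n)
    differences-coverFree {s} {F} (c₀∷F! , fp) {y} y∈F {X} X⊆F y∉X |X|≤s covered
      with ∈-deduplicate⁻ _≟ʷ_ (c₀ ∷ X) (fp X₀ small y (there y∈F) inWdesc)
      where
      -- `X` may have repetitions, whereas a `SmallSubset` is duplicate-free.
      X₀ : List (Word q n)
      X₀ = deduplicate _≟ʷ_ (c₀ ∷ X)
      X₀⊆ : X₀ ⊆ c₀ ∷ F
      X₀⊆ x∈ with ∈-deduplicate⁻ _≟ʷ_ (c₀ ∷ X) x∈
      ... | here refl = here refl
      ... | there x∈X = there (X⊆F x∈X)
      small : SmallSubset (suc s) (c₀ ∷ F) X₀
      small = deduplicate-! _≟ʷ_ (c₀ ∷ X) , X₀⊆ , s≤s z≤n , ≤-trans (length-deduplicate _≟ʷ_ (c₀ ∷ X)) (s≤s |X|≤s)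
      inWdesc : InWdesc X₀ y
      inWdesc i undet {c} c∈X₀ with lookup y i ≟ lookup c₀ i
      ... | yes y≡c₀ = trans y≡c₀ (undet (here refl) c∈X₀)
      ... | no  y≢c₀ with find (covered (∈-allFin i) y≢c₀)
      ...   | x , x∈X , x≢c₀ = contradiction (undet (∈-deduplicate⁺ _≟ʷ_ (there x∈X)) (here refl)) x≢c₀
    ... | here refl = Unique.Unique[x∷xs]⇒x∉xs c₀∷F! y∈F
    ... | there y∈X = y∉X y∈X

  -- With t = 3 + r the differences from the first codeword are (t - 1)-cover-free, so
  -- `coverFree-bound` applies at s = 2 + r.
  frameproof-bound : ∀ r (C : List (Word q n)) → WideSenseFrameproof (3 + r) C →
                     ∃[ u ] u * ((2 + r) * (1 + r)) ≤ 2 * n × length C ≤ (8 * (3 + r)) ^ (2 + u)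
  frameproof-bound r []       _  = 0 , z≤n , z≤n
  frameproof-bound r (c₀ ∷ F) fp@(_ ∷ F! , _) =
    conclude (coverFree-bound r F (allFin n) F! (Unique.allFin⁺ n) (differences-coverFree fp))
    where
    open Differences c₀
    conclude : Bounded r F (allFin n) → ∃[ u ] u * ((2 + r) * (1 + r)) ≤ 2 * n × suc (length F) ≤ (8 * (3 + r)) ^ (2 + u)
    conclude (u , u≤ , F≤) = u , ≤-trans u≤ (≤-reflexive (cong (2 *_) (length-tabulate {n = n} id))) ,
      ≤-trans (s≤s F≤) (1+bound≤[8t]^[2+u] (2 + r) (3 + r) u ≤-refl)

wideSense-bound : ∀ q → AsymptoticBound q (λ t C → WideSenseFrameproof t C)
-- `8 ^ a ≤ t` serves `power-≤`; `3 * suc a ≤ t` controls t²/((t - 1)(t - 2)) and gives t ≥ 3. The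
-- threshold on `n` absorbs the additive 2 of the exponent.
wideSense-bound q k 1≤k = 8 ^ a + 3 * suc a , λ t _ T≤t → suc a * (t * t) , λ n N≤n C fp →
  main t T≤t n N≤n C fp
  where
  instance
    k≢0 : NonZero k
    k≢0 = >-nonZero 1≤k
  a = 8 * k
  main : ∀ t → 8 ^ a + 3 * suc a ≤ t → ∀ n → suc a * (t * t) ≤ n → ∀ (C : List (Word q n)) → WideSenseFrameproof t C →
         length C ^ (k * (t * t)) ≤ t ^ ((2 * k + 1) * n)
  main t T≤t n N≤n C fp = go (t ∸ 3) (m+[n∸m]≡n {3} {t} (≤-trans (m≤m*n 3 (suc a)) 3[1+a]≤t))
    where
    3[1+a]≤t : 3 * suc a ≤ t
    3[1+a]≤t = m+n≤o⇒n≤o (8 ^ a) T≤t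
    go : ∀ r → 3 + r ≡ t → length C ^ (k * (t * t)) ≤ t ^ ((2 * k + 1) * n)
    go r refl = conclude (frameproof-bound r C fp)
      where
      conclude : ∃[ u ] u * ((2 + r) * (1 + r)) ≤ 2 * n × length C ≤ (8 * (3 + r)) ^ (2 + u) →
                 length C ^ (k * (t * t)) ≤ t ^ ((2 * k + 1) * n)
      conclude (u , u≤ , C≤) =
        power-≤ a {{m*n≢0 8 k}} t (length C) (2 + u) (k * (t * t)) ((2 * k + 1) * n) (m+n≤o⇒m≤o (8 ^ a) T≤t) C≤
          (exponent-≤ k a (t * t) ((2 + r) * (1 + r)) u n refl (at²≤[1+a][t-1][t-2] a r 3[1+a]≤t) u≤ N≤n)

-- The binary case.

-- If `y` differed at `i` from every word of `X`, all of these would carry the other bit there. Then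
-- `i` would be undetectable and `y` would have to agree with them.
inWdesc⇒inDesc : ∀ {n} (X : List (Word 2 n)) → 1 ≤ length X → ∀ y → InWdesc X y → InDesc X y
inWdesc⇒inDesc X@(_ ∷ _) _ y wdesc i with Any.any? (λ x → lookup y i ≟ lookup x i) X
... | yes p = find p
... | no ¬p = contradiction (here (wdesc i undetectable (here refl))) ¬p
  where
  both-differ : ∀ (a b d : Fin 2) → a ≢ b → a ≢ d → b ≡ d
  both-differ zero       zero       _          a≢b _   = contradiction refl a≢b
  both-differ (suc zero) (suc zero) _          a≢b _   = contradiction refl a≢b
  both-differ zero       (suc zero) zero       _   a≢d = contradiction refl a≢d
  both-differ zero       (suc zero) (suc zero) _   _   = refl
  both-differ (suc zero) zero       zero       _   _   = refl
  both-differ (suc zero) zero       (suc zero) _   a≢d = contradiction refl a≢d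
  undetectable : Undetectable X i
  undetectable x∈X x′∈X = both-differ (lookup y i) _ _ (λ e → ¬p (lose x∈X e)) (λ e → ¬p (lose x′∈X e))

binary⇒wideSense : ∀ {t n} {C : List (Word 2 n)} → BinaryFrameproof t C → WideSenseFrameproof t C
binary⇒wideSense (C! , fp) = C! , λ X small@(_ , _ , 1≤|X| , _) y y∈C wdesc → fp X small y y∈C (inWdesc⇒inDesc X 1≤|X| y wdesc)

binary-bound : AsymptoticBound 2 (λ t C → BinaryFrameproof t C)
binary-bound k 1≤k with T , bounds ← wideSense-bound 2 k 1≤k = T , λ t 2≤t T≤t →
  proj₁ (bounds t 2≤t T≤t) , λ n N≤n C fp → proj₂ (bounds t 2≤t T≤t) n N≤n C (binary⇒wideSense fp)

theorem1p10 : (∀ (q : ℕ) → 2 ≤ q → AsymptoticBound q (λ t C → WideSenseFrameproof t C))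
    × AsymptoticBound 2 (λ t C → BinaryFrameproof t C)
theorem1p10 = (λ q _ → wideSense-bound q) , binary-bound
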